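{- Let $n_0,n_1,n_2,n_3,n_4\in\mathbb{Z}_{>0}$ and let $X=[n_0;n_1,n_2,n_3,n_4]=n_0+\cfrac{1}{n_1+\cfrac{1}{n_2+\cfrac{1}{n_3+\cfrac{1}{n_4}}}}$. Then the rational-indexed Fibonacci number $F_X:=\mathrm{F}(X)$ is given by $$\begin{aligned}F_X={}&\Big(\big((F_{n_3-2}F_{n_2-1}+F_{n_3-1}L_{n_2-2})F_{n_1}+(F_{n_3-2}F_{n_2}+F_{n_3-1}L_{n_2-1})L_{n_1-1}\big)L_{n_0}\\&\quad+\big((F_{n_3-2}F_{n_2-1}+F_{n_3-1}L_{n_2-2})F_{n_1-1}+(F_{n_3-2}F_{n_2}+F_{n_3-1}L_{n_2-1})L_{n_1-2}\big)F_{n_0+1}\Big)F_{n_4}\\&+\Big(\big((F_{n_3-3}F_{n_2-1}+F_{n_3-2}L_{n_2-2})F_{n_1}+(F_{n_3-3}F_{n_2}+F_{n_3-2}L_{n_2-1})L_{n_1-1}\big)L_{n_0}\\&\quad+\big((F_{n_3-3}F_{n_2-1}+F_{n_3-2}L_{n_2-2})F_{n_1-1}+(F_{n_3-3}F_{n_2}+F_{n_3-2}L_{n_2-1})L_{n_1-2}\big)F_{n_0+1}\Big)F_{n_4+1}.\end{aligned}$$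
   Context: The conumerator function is the unique map $\mathrm{con}:\mathbb{Q}_{>0}\to\mathbb{Z}_{>0}$ with $\mathrm{con}(1)=1$ and, for all $X\in\mathbb{Q}_{>0}$, $\mathrm{con}(1+X)=\mathrm{con}(X)+\mathrm{con}(1/X)$ and $\mathrm{con}\left(\tfrac{1}{1+X}\right)=\mathrm{con}(X)$. The codenominator function is $\mathrm{F}(X):=\mathrm{con}(1/X)$ for $X\in\mathbb{Q}_{>0}$; equivalently $\mathrm{F}(1)=1$, $\mathrm{F}(1+X)=\mathrm{F}(1/X)$, $\mathrm{F}\left(\tfrac{1}{1+X}\right)=\mathrm{F}(X)+\mathrm{F}(1/X)$. The Fibonacci numbers are $F_0=0$, $F_1=1$, $F_n=F_{n-1}+F_{n-2}$, and the Lucas numbers are $L_0=2$, $L_1=1$, $L_n=L_{n-1}+L_{n-2}$; for negative indices $F_{ -n}=(-1)^{n-1}F_n$ and $L_{ -n}=(-1)^nL_n$. -}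

module Defs where

open import Data.Integer.Base as ℤ using (ℤ; +_; +[1+_]; -[1+_]; -1ℤ; 1ℤ)
open import Data.Irrelevant using ([_])
open import Data.Nat.Base as ℕ using (ℕ; zero; suc; less; equal; greater)
import Data.Nat.Coprimality as Coprimality
import Data.Nat.Divisibility as Div
import Data.Nat.Properties as ℕₚ
open import Data.Nat.Solver using (module +-*-Solver)
open import Data.Product.Base using (_,_)
open import Data.Rational.Base as ℚ using (ℚ; mkℚ; 1ℚ)
import Data.Rational.Properties as ℚₚ
import Data.Rational.Unnormalised.Base as ℚᵘ
import Data.Rational.Unnormalised.Properties as ℚᵘₚ
open import Data.Refinement using (Refinement-syntax; value; _,_; value-injective)
open import Relation.Binary.PropositionalEquality
  using (_≡_; refl; sym; trans; cong; cong₂; subst)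

ℚ>0 : Set
ℚ>0 = [ q ∈ ℚ ∣ ℚ.Positive q ]

ℤ>0 : Set
ℤ>0 = [ z ∈ ℤ ∣ ℤ.Positive z ]

infixl 6 _⊕_

_⊕_ : ℚ>0 → ℚ>0 → ℚ>0
(p , [ p>0 ]) ⊕ (q , [ q>0 ]) =
  p ℚ.+ q , [ ℚₚ.pos+pos⇒pos p {{p>0}} q {{q>0}} ]

recip : ℚ>0 → ℚ>0
recip (p , [ p>0 ]) =
  (ℚ.1/ p) {{ℚₚ.pos⇒nonZero p {{p>0}}}} , [ ℚₚ.1/pos⇒pos p {{p>0}} ]

fromℤ : (n : ℤ) → .{{ℤ.Positive n}} → ℚ>0
fromℤ n@(+[1+ m ]) = n ℚ./ 1 , [ ℚₚ.normalize-pos (suc m) 1 ]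

one : ℚ>0
one = fromℤ 1ℤ

record IsConumerator (con : ℚ>0 → ℤ>0) : Set where
  field
    con-one     : value (con one) ≡ 1ℤ
    con-1+X     : ∀ X → value (con (one ⊕ X)) ≡
                        value (con X) ℤ.+ value (con (recip X))
    con-1/[1+X] : ∀ X → value (con (recip (one ⊕ X))) ≡ value (con X)

codenominator : (ℚ>0 → ℤ>0) → ℚ>0 → ℤ>0
codenominator con X = con (recip X)

fibℕ : ℕ → ℕ
fibℕ 0             = 0
fibℕ 1             = 1
fibℕ (suc (suc n)) = fibℕ (suc n) ℕ.+ fibℕ n

lucasℕ : ℕ → ℕ
lucasℕ 0             = 2
lucasℕ 1             = 1
lucasℕ (suc (suc n)) = lucasℕ (suc n) ℕ.+ lucasℕ n

-- Since -[1+ n ] is -(n + 1), the sign (-1)ᵐ⁻¹ in F₋ₘ = (-1)ᵐ⁻¹Fₘ becomes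
-- (-1)ⁿ, and the sign (-1)ᵐ in L₋ₘ = (-1)ᵐLₘ becomes (-1)ⁿ⁺¹.

F : ℤ → ℤ
F (+ n)    = + fibℕ n
F -[1+ n ] = (-1ℤ ℤ.^ n) ℤ.* + fibℕ (suc n)

L : ℤ → ℤ
L (+ n)    = + lucasℕ n
L -[1+ n ] = (-1ℤ ℤ.^ suc n) ℤ.* + lucasℕ (suc n)

-- A conumerator function exists, so results about an arbitrary con satisfying
-- IsConumerator con are not vacuous.

private

  -- With enough fuel, conℕ k i j is the conumerator of (i + 1) / (j + 1).
  conℕ : ℕ → ℕ → ℕ → ℕ
  conℕ zero    i j = 1
  conℕ (suc k) i j with ℕ.compare i j
  ... | equal _     = 1
  ... | less _ d    = conℕ k d i
  ... | greater _ d = conℕ k d j ℕ.+ conℕ k j d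

  conℕ-pos : ∀ k i j → ℤ.Positive (+ conℕ k i j)
  conℕ-pos zero    i j = _
  conℕ-pos (suc k) i j with ℕ.compare i j
  ... | equal _     = _
  ... | less _ d    = conℕ-pos k d i
  ... | greater _ d with conℕ k d j | conℕ-pos k d j
  ...   | suc _ | _ = _

  compare-less : ∀ m d → ℕ.compare m (suc (m ℕ.+ d)) ≡ less m d
  compare-less zero    d = refl
  compare-less (suc m) d rewrite compare-less m d = refl

  compare-greater : ∀ m d → ℕ.compare (suc (m ℕ.+ d)) m ≡ greater m d
  compare-greater zero    d = refl
  compare-greater (suc m) d rewrite compare-greater m d = refl

  -- The value does not depend on the fuel, once this exceeds i + j.
  conℕ-fuel : ∀ k l i j → i ℕ.+ j ℕ.< k → i ℕ.+ j ℕ.< l →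
              conℕ k i j ≡ conℕ l i j
  conℕ-fuel (suc k) (suc l) i j (ℕ.s≤s p) (ℕ.s≤s q) with ℕ.compare i j
  ... | equal _     = refl
  ... | less _ d    = conℕ-fuel k l d i (lt p) (lt q)
    where
    lt : ∀ {m} → i ℕ.+ suc (i ℕ.+ d) ℕ.≤ m → d ℕ.+ i ℕ.< m
    lt r = ℕₚ.≤-trans (ℕ.s≤s (ℕₚ.≤-reflexive (ℕₚ.+-comm d i)))
                      (ℕₚ.≤-trans (ℕₚ.m≤n+m _ i) r)
  ... | greater _ d = cong₂ ℕ._+_
      (conℕ-fuel k l d j (subst (ℕ._< k) (ℕₚ.+-comm j d) (lt p))
                         (subst (ℕ._< l) (ℕₚ.+-comm j d) (lt q)))
      (conℕ-fuel k l j d (lt p) (lt q))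
    where
    lt : ∀ {m} → suc (j ℕ.+ d) ℕ.+ j ℕ.≤ m → j ℕ.+ d ℕ.< m
    lt r = ℕₚ.≤-trans (ℕₚ.m≤m+n _ j) r

  coprime-suc : ∀ {i j} → Coprimality.Coprime (suc i) (suc j) →
                Coprimality.Coprime (suc (suc (j ℕ.+ i))) (suc j)
  coprime-suc {i} {j} c {d} (d∣s , d∣j) =
    c (Div.∣m+n∣m⇒∣n (subst (d Div.∣_) (sym (ℕₚ.+-suc (suc j) i)) d∣s) d∣j , d∣j)

  1+mkℚ : ∀ i j .(c : Coprimality.Coprime (suc i) (suc j)) →
          1ℚ ℚ.+ mkℚ +[1+ i ] j c ≡ mkℚ +[1+ suc (j ℕ.+ i) ] j (coprime-suc c)
  1+mkℚ i j c = ℚₚ.toℚᵘ-injective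
    (ℚᵘₚ.≃-trans (ℚₚ.toℚᵘ-homo-+ 1ℚ (mkℚ +[1+ i ] j c))
                 (ℚᵘ.*≡* (cong +_ (lemma i j))))
    where
    open +-*-Solver
    lemma : ∀ i j → (suc (j ℕ.+ 0) ℕ.+ suc (i ℕ.* 1)) ℕ.* suc j ≡
                    suc (suc (j ℕ.+ i)) ℕ.* suc (j ℕ.+ 0)
    lemma = solve 2 (λ i j →
      ((con 1 :+ (j :+ con 0)) :+ (con 1 :+ i :* con 1)) :* (con 1 :+ j) :=
      (con 2 :+ (j :+ i)) :* (con 1 :+ (j :+ con 0))) refl

  conℕ-1+ : ∀ i j → conℕ (suc (suc (j ℕ.+ i) ℕ.+ j)) (suc (j ℕ.+ i)) j ≡
            conℕ (suc (i ℕ.+ j)) i j ℕ.+ conℕ (suc (j ℕ.+ i)) j i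
  conℕ-1+ i j rewrite compare-greater j i = cong₂ ℕ._+_
    (conℕ-fuel (suc (j ℕ.+ i) ℕ.+ j) (suc (i ℕ.+ j)) i j
      (ℕ.s≤s (ℕₚ.+-monoˡ-≤ j (ℕₚ.m≤n+m i j))) ℕₚ.≤-refl)
    (conℕ-fuel (suc (j ℕ.+ i) ℕ.+ j) (suc (j ℕ.+ i)) j i
      (ℕₚ.m≤m+n _ j) ℕₚ.≤-refl)

  conℕ-1/[1+] : ∀ i j → conℕ (suc (j ℕ.+ suc (j ℕ.+ i))) j (suc (j ℕ.+ i)) ≡
                conℕ (suc (i ℕ.+ j)) i j
  conℕ-1/[1+] i j rewrite compare-less j i =
    conℕ-fuel (j ℕ.+ suc (j ℕ.+ i)) (suc (i ℕ.+ j)) i j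
      (subst (ℕ._≤ j ℕ.+ suc (j ℕ.+ i)) (cong suc (ℕₚ.+-comm j i)) (ℕₚ.m≤n+m _ j))
      ℕₚ.≤-refl

conumerator : ℚ>0 → ℤ>0
conumerator (mkℚ +[1+ i ] j _ , _) =
  + conℕ (suc (i ℕ.+ j)) i j , [ conℕ-pos (suc (i ℕ.+ j)) i j ]

conumerator-isConumerator : IsConumerator conumerator
conumerator-isConumerator = record
  { con-one     = refl
  ; con-1+X     = step₁
  ; con-1/[1+X] = step₂
  }
  where
  1+X : ∀ i j .(c : Coprimality.Coprime (suc i) (suc j)) →
        one ⊕ (mkℚ +[1+ i ] j c , [ _ ]) ≡
        (mkℚ +[1+ suc (j ℕ.+ i) ] j (coprime-suc c) , [ _ ])
  1+X i j c = value-injective (1+mkℚ i j c)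

  step₁ : ∀ X → value (conumerator (one ⊕ X)) ≡
                value (conumerator X) ℤ.+ value (conumerator (recip X))
  step₁ (mkℚ +[1+ i ] j c , _) =
    trans (cong (λ Y → value (conumerator Y)) (1+X i j c))
          (cong +_ (conℕ-1+ i j))

  step₂ : ∀ X → value (conumerator (recip (one ⊕ X))) ≡ value (conumerator X)
  step₂ (mkℚ +[1+ i ] j c , _) =
    trans (cong (λ Y → value (conumerator (recip Y))) (1+X i j c))
          (cong +_ (conℕ-1/[1+] i j))

{-# OPTIONS --safe #-}
module Submission where

-- Put v(X) = (con X, con (1/X)). Inverting X swaps the entries of v(X), and
-- adding the integer n acts on v(X) by the Fibonacci matrix with rows
-- (F(n+1), F n) and (F n, F(n-1)), so the value at a continued fraction is
-- multilinear in the pairs (F nᵢ, F(nᵢ-1)). Every Fibonacci and Lucas number in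
-- the formula is a linear form in such a pair, e.g. L(n-2) = 3 F(n-1) - F n,
-- and after this substitution the formula is an identity of integer polynomials.

open import Defs
open import Data.Integer.Base using (ℤ; +_; +[1+_]; 1ℤ; Positive; _+_; _-_; _*_)
import Data.Integer.Properties as ℤₚ
import Data.Integer.Tactic.RingSolver as ℤSolver
open import Data.Nat.Base using (zero; suc)
import Data.Rational.Base as ℚ
import Data.Rational.Properties as ℚₚ
import Data.Rational.Unnormalised.Base as ℚᵘ
import Data.Rational.Unnormalised.Properties as ℚᵘₚ
open import Data.Refinement using (value; value-injective; _,_)
open import Relation.Binary.PropositionalEquality
  using (_≡_; refl; sym; trans; cong; cong₂; module ≡-Reasoning)

-- Reduction to lowest terms in `fromℤ` goes through a gcd that is stuck on a variable `m`. The
-- equality is therefore checked by cross-multiplication of unnormalised fractions.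
fromℤ-suc : ∀ m → fromℤ +[1+ suc m ] ≡ one ⊕ fromℤ +[1+ m ]
fromℤ-suc m = value-injective (ℚₚ.toℚᵘ-injective (begin
  ℚ.toℚᵘ (ℚ.fromℚᵘ (ℚᵘ.mkℚᵘ +[1+ suc m ] 0))               ≈⟨ ℚₚ.toℚᵘ-fromℚᵘ (ℚᵘ.mkℚᵘ +[1+ suc m ] 0) ⟩
  ℚᵘ.mkℚᵘ +[1+ suc m ] 0                                   ≈⟨ ℚᵘ.*≡* (lemma +[1+ m ]) ⟩
  ℚ.toℚᵘ ℚ.1ℚ ℚᵘ.+ ℚᵘ.mkℚᵘ +[1+ m ] 0                      ≈⟨ ℚᵘₚ.+-congʳ (ℚ.toℚᵘ ℚ.1ℚ) (ℚᵘₚ.≃-sym (ℚₚ.toℚᵘ-fromℚᵘ (ℚᵘ.mkℚᵘ +[1+ m ] 0))) ⟩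
  ℚ.toℚᵘ ℚ.1ℚ ℚᵘ.+ ℚ.toℚᵘ (ℚ.fromℚᵘ (ℚᵘ.mkℚᵘ +[1+ m ] 0))  ≈⟨ ℚᵘₚ.≃-sym (ℚₚ.toℚᵘ-homo-+ ℚ.1ℚ (ℚ.fromℚᵘ (ℚᵘ.mkℚᵘ +[1+ m ] 0))) ⟩
  ℚ.toℚᵘ (ℚ.1ℚ ℚ.+ ℚ.fromℚᵘ (ℚᵘ.mkℚᵘ +[1+ m ] 0))          ∎))
  where
  open ℚᵘₚ.≃-Reasoning
  lemma : ∀ x → (1ℤ + x) * 1ℤ ≡ (1ℤ + x * 1ℤ) * 1ℤ
  lemma = ℤSolver.solve-∀

⊕-assoc : ∀ X Y Z → (X ⊕ Y) ⊕ Z ≡ X ⊕ (Y ⊕ Z)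
⊕-assoc X Y Z = value-injective (ℚₚ.+-assoc (value X) (value Y) (value Z))

-- Once the positive numerator is exposed, inversion just swaps numerator and denominator, so both
-- sides agree by computation.
recip-involutive : ∀ X → recip (recip X) ≡ X
recip-involutive (ℚ.mkℚ +[1+ _ ] _ _ , _) = refl

-- In these lemmas n = m + 1, so that F(n-1) is F (+ m).

F[n-2] : ∀ m → F (+[1+ m ] - + 2) ≡ F +[1+ m ] - F (+ m)
F[n-2] zero    = refl
F[n-2] (suc m) = lemma (F (+ suc m)) (F (+ m))
  where
  lemma : ∀ q p → p ≡ q + p - q
  lemma = ℤSolver.solve-∀

F[n-3] : ∀ m → F (+[1+ m ] - + 3) ≡ + 2 * F (+ m) - F +[1+ m ]
-- For n = 1 and n = 2 the sign convention enters, with F(-2) = -1 and F(-1) = 1; from n = 3 on the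
-- recurrence suffices.
F[n-3] zero          = refl
F[n-3] (suc zero)    = refl
F[n-3] (suc (suc m)) = lemma (F (+ suc m)) (F (+ m))
  where
  lemma : ∀ q p → p ≡ + 2 * (q + p) - (q + p + q)
  lemma = ℤSolver.solve-∀

L[n-1] : ∀ m → L (+[1+ m ] - + 1) ≡ + 2 * F +[1+ m ] - F (+ m)
L[n-1] zero          = refl
L[n-1] (suc zero)    = refl
-- Both sides obey the Fibonacci recurrence in n, hence an induction from two predecessors. The
-- forms for L(n-2) and L(n) are index shifts of this one.
L[n-1] (suc (suc m)) =
  trans (cong₂ _+_ (L[n-1] (suc m)) (L[n-1] m)) (lemma (F (+ suc m)) (F (+ m)))
  where
  lemma : ∀ q p → (+ 2 * (q + p) - q) + (+ 2 * q - p) ≡ + 2 * (q + p + q) - (q + p)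
  lemma = ℤSolver.solve-∀

L[n-2] : ∀ m → L (+[1+ m ] - + 2) ≡ + 3 * F (+ m) - F +[1+ m ]
L[n-2] zero    = refl
L[n-2] (suc m) = trans (L[n-1] m) (lemma (F (+ suc m)) (F (+ m)))
  where
  lemma : ∀ q p → + 2 * q - p ≡ + 3 * q - (q + p)
  lemma = ℤSolver.solve-∀

L[n] : ∀ m → L +[1+ m ] ≡ F +[1+ m ] + + 2 * F (+ m)
L[n] m = trans (L[n-1] (suc m)) (lemma (F +[1+ m ]) (F (+ m)))
  where
  lemma : ∀ q p → + 2 * (q + p) - q ≡ q + + 2 * p
  lemma = ℤSolver.solve-∀

F[n+1] : ∀ m → F (+[1+ m ] + + 1) ≡ F +[1+ m ] + F (+ m)
F[n+1] m = cong F (ℤₚ.+-comm +[1+ m ] 1ℤ)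

module _ (con : ℚ>0 → ℤ>0) (isConumerator : IsConumerator con) where

  open IsConumerator isConumerator

  con′ : ℚ>0 → ℤ
  con′ X = value (con X)

  -- The sum is F(n+1) for n = m + 1, kept in terms of the pair (F n, F(n-1)). The two claims are
  -- proved together because adding 1 to X involves `con` at both X and 1/X.
  con-fromℤ : ∀ m → con′ (fromℤ +[1+ m ]) ≡ F +[1+ m ] + F (+ m)
  con-recip-fromℤ : ∀ m → con′ (recip (fromℤ +[1+ m ])) ≡ F +[1+ m ]

  con-fromℤ zero    = con-one
  con-fromℤ (suc m) = begin
    con′ (fromℤ +[1+ suc m ])                              ≡⟨ cong con′ (fromℤ-suc m) ⟩
    con′ (one ⊕ fromℤ +[1+ m ])                            ≡⟨ con-1+X _ ⟩
    con′ (fromℤ +[1+ m ]) + con′ (recip (fromℤ +[1+ m ]))  ≡⟨ cong₂ _+_ (con-fromℤ m) (con-recip-fromℤ m) ⟩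
    F +[1+ suc m ] + F +[1+ m ]                            ∎
    where open ≡-Reasoning

  -- `recip one` computes to `one`, so the same axiom settles both base cases.
  con-recip-fromℤ zero    = con-one
  con-recip-fromℤ (suc m) = begin
    con′ (recip (fromℤ +[1+ suc m ]))    ≡⟨ cong (λ X → con′ (recip X)) (fromℤ-suc m) ⟩
    con′ (recip (one ⊕ fromℤ +[1+ m ]))  ≡⟨ con-1/[1+X] _ ⟩
    con′ (fromℤ +[1+ m ])                ≡⟨ con-fromℤ m ⟩
    F +[1+ suc m ]                       ∎
    where open ≡-Reasoning

  -- Induction on n = m + 1: associativity brings a `one` to the front, and adding it replaces the
  -- two rows by their sum and the old first row, which is the Fibonacci recurrence.
  con-⊕ : ∀ m X → con′ (fromℤ +[1+ m ] ⊕ X) ≡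
          (F +[1+ m ] + F (+ m)) * con′ X + F +[1+ m ] * con′ (recip X)
  con-recip-⊕ : ∀ m X → con′ (recip (fromℤ +[1+ m ] ⊕ X)) ≡
                F +[1+ m ] * con′ X + F (+ m) * con′ (recip X)

  con-⊕ zero    X = trans (con-1+X X) (lemma (con′ X) (con′ (recip X)))
    where
    lemma : ∀ a b → a + b ≡ + 1 * a + + 1 * b
    lemma = ℤSolver.solve-∀
  con-⊕ (suc m) X = begin
    con′ (fromℤ +[1+ suc m ] ⊕ X)                                    ≡⟨ cong (λ N → con′ (N ⊕ X)) (fromℤ-suc m) ⟩
    con′ ((one ⊕ fromℤ +[1+ m ]) ⊕ X)                                ≡⟨ cong con′ (⊕-assoc one (fromℤ +[1+ m ]) X) ⟩
    con′ (one ⊕ (fromℤ +[1+ m ] ⊕ X))                                ≡⟨ con-1+X _ ⟩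
    con′ (fromℤ +[1+ m ] ⊕ X) + con′ (recip (fromℤ +[1+ m ] ⊕ X))    ≡⟨ cong₂ _+_ (con-⊕ m X) (con-recip-⊕ m X) ⟩
    _                                                                ≡⟨ lemma (F +[1+ m ]) (F (+ m)) (con′ X) (con′ (recip X)) ⟩
    (F +[1+ suc m ] + F +[1+ m ]) * con′ X + F +[1+ suc m ] * con′ (recip X) ∎
    where
    open ≡-Reasoning
    lemma : ∀ q p a b → (q + p) * a + q * b + (q * a + p * b) ≡ (q + p + q) * a + (q + p) * b
    lemma = ℤSolver.solve-∀

  con-recip-⊕ zero    X = trans (con-1/[1+X] X) (lemma (con′ X) (con′ (recip X)))
    where
    lemma : ∀ a b → a ≡ + 1 * a + + 0 * b
    lemma = ℤSolver.solve-∀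
  con-recip-⊕ (suc m) X = begin
    con′ (recip (fromℤ +[1+ suc m ] ⊕ X))      ≡⟨ cong (λ N → con′ (recip (N ⊕ X))) (fromℤ-suc m) ⟩
    con′ (recip ((one ⊕ fromℤ +[1+ m ]) ⊕ X))  ≡⟨ cong (λ Y → con′ (recip Y)) (⊕-assoc one (fromℤ +[1+ m ]) X) ⟩
    con′ (recip (one ⊕ (fromℤ +[1+ m ] ⊕ X)))  ≡⟨ con-1/[1+X] _ ⟩
    con′ (fromℤ +[1+ m ] ⊕ X)                  ≡⟨ con-⊕ m X ⟩
    F +[1+ suc m ] * con′ X + F +[1+ m ] * con′ (recip X) ∎
    where open ≡-Reasoning

  -- One level of the continued fraction: `recip X` has the values of `X` in swapped order, so `b`
  -- takes the coefficient that stood at `con′ X`. Naming the values `a` and `b` lets the levels be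
  -- chained.
  con-⊕-recip : ∀ m {X a b} → con′ X ≡ a → con′ (recip X) ≡ b →
                con′ (fromℤ +[1+ m ] ⊕ recip X) ≡
                (F +[1+ m ] + F (+ m)) * b + F +[1+ m ] * a
  con-⊕-recip m {X} refl refl = trans (con-⊕ m (recip X))
    (cong (λ Y → (F +[1+ m ] + F (+ m)) * con′ (recip X) + F +[1+ m ] * con′ Y) (recip-involutive X))

  con-recip-⊕-recip : ∀ m {X a b} → con′ X ≡ a → con′ (recip X) ≡ b →
                      con′ (recip (fromℤ +[1+ m ] ⊕ recip X)) ≡
                      F +[1+ m ] * b + F (+ m) * a
  con-recip-⊕-recip m {X} refl refl = trans (con-recip-⊕ m (recip X))
    (cong (λ Y → F +[1+ m ] * con′ (recip X) + F (+ m) * con′ Y) (recip-involutive X))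

-- The equations come as hypotheses on variables, because rewriting F and L in place
-- makes Agda normalise the integer arithmetic.
continuant-identity : ∀ q₀ p₀ q₁ p₁ q₂ p₂ q₃ p₃ q₄ p₄ {l₀ f₀ l₁′ l₁″ l₂′ l₂″ f₃′ f₃″ f₄} →
    l₀ ≡ q₀ + + 2 * p₀ → f₀ ≡ q₀ + p₀ →
    l₁′ ≡ + 2 * q₁ - p₁ → l₁″ ≡ + 3 * p₁ - q₁ →
    l₂′ ≡ + 2 * q₂ - p₂ → l₂″ ≡ + 3 * p₂ - q₂ →
    f₃′ ≡ q₃ - p₃ → f₃″ ≡ + 2 * p₃ - q₃ →
    f₄ ≡ q₄ + p₄ →
    let a₃ = (q₃ + p₃) * q₄ + q₃ * (q₄ + p₄)
        b₃ = q₃ * q₄ + p₃ * (q₄ + p₄)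
        a₂ = (q₂ + p₂) * b₃ + q₂ * a₃
        b₂ = q₂ * b₃ + p₂ * a₃
        a₁ = (q₁ + p₁) * b₂ + q₁ * a₂
        b₁ = q₁ * b₂ + p₁ * a₂
    in
    q₀ * b₁ + p₀ * a₁
    ≡
    ( ( (f₃′ * p₂ + p₃ * l₂″) * q₁
      + (f₃′ * q₂ + p₃ * l₂′) * l₁′ ) * l₀
    + ( (f₃′ * p₂ + p₃ * l₂″) * p₁
      + (f₃′ * q₂ + p₃ * l₂′) * l₁″ ) * f₀
    ) * q₄
    +
    ( ( (f₃″ * p₂ + f₃′ * l₂″) * q₁
      + (f₃″ * q₂ + f₃′ * l₂′) * l₁′ ) * l₀
    + ( (f₃″ * p₂ + f₃′ * l₂″) * p₁
      + (f₃″ * q₂ + f₃′ * l₂′) * l₁″ ) * f₀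
    ) * f₄
continuant-identity q₀ p₀ q₁ p₁ q₂ p₂ q₃ p₃ q₄ p₄ refl refl refl refl refl refl refl refl refl =
  lemma q₀ p₀ q₁ p₁ q₂ p₂ q₃ p₃ q₄ p₄
  where
  lemma : ∀ q₀ p₀ q₁ p₁ q₂ p₂ q₃ p₃ q₄ p₄ →
    let a₃ = (q₃ + p₃) * q₄ + q₃ * (q₄ + p₄)
        b₃ = q₃ * q₄ + p₃ * (q₄ + p₄)
        a₂ = (q₂ + p₂) * b₃ + q₂ * a₃
        b₂ = q₂ * b₃ + p₂ * a₃
        a₁ = (q₁ + p₁) * b₂ + q₁ * a₂
        b₁ = q₁ * b₂ + p₁ * a₂
    in
    q₀ * b₁ + p₀ * a₁
    ≡
    ( ( ((q₃ - p₃) * p₂ + p₃ * (+ 3 * p₂ - q₂)) * q₁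
      + ((q₃ - p₃) * q₂ + p₃ * (+ 2 * q₂ - p₂)) * (+ 2 * q₁ - p₁) ) * (q₀ + + 2 * p₀)
    + ( ((q₃ - p₃) * p₂ + p₃ * (+ 3 * p₂ - q₂)) * p₁
      + ((q₃ - p₃) * q₂ + p₃ * (+ 2 * q₂ - p₂)) * (+ 3 * p₁ - q₁) ) * (q₀ + p₀)
    ) * q₄
    +
    ( ( ((+ 2 * p₃ - q₃) * p₂ + (q₃ - p₃) * (+ 3 * p₂ - q₂)) * q₁
      + ((+ 2 * p₃ - q₃) * q₂ + (q₃ - p₃) * (+ 2 * q₂ - p₂)) * (+ 2 * q₁ - p₁) ) * (q₀ + + 2 * p₀)
    + ( ((+ 2 * p₃ - q₃) * p₂ + (q₃ - p₃) * (+ 3 * p₂ - q₂)) * p₁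
      + ((+ 2 * p₃ - q₃) * q₂ + (q₃ - p₃) * (+ 2 * q₂ - p₂)) * (+ 3 * p₁ - q₁) ) * (q₀ + p₀)
    ) * (q₄ + p₄)
  lemma = ℤSolver.solve-∀

lemma3p4 :
  (con : ℚ>0 → ℤ>0) → IsConumerator con →
  (n₀ n₁ n₂ n₃ n₄ : ℤ)
  .{{_ : Positive n₀}} .{{_ : Positive n₁}} .{{_ : Positive n₂}}
  .{{_ : Positive n₃}} .{{_ : Positive n₄}} →
  value (codenominator con
    (fromℤ n₀ ⊕ recip (fromℤ n₁ ⊕ recip (fromℤ n₂ ⊕ recip (fromℤ n₃ ⊕ recip (fromℤ n₄))))))
  ≡
  ( ( (F (n₃ - + 2) * F (n₂ - + 1) + F (n₃ - + 1) * L (n₂ - + 2)) * F n₁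
    + (F (n₃ - + 2) * F n₂ + F (n₃ - + 1) * L (n₂ - + 1)) * L (n₁ - + 1) ) * L n₀
  + ( (F (n₃ - + 2) * F (n₂ - + 1) + F (n₃ - + 1) * L (n₂ - + 2)) * F (n₁ - + 1)
    + (F (n₃ - + 2) * F n₂ + F (n₃ - + 1) * L (n₂ - + 1)) * L (n₁ - + 2) ) * F (n₀ + + 1)
  ) * F n₄
  +
  ( ( (F (n₃ - + 3) * F (n₂ - + 1) + F (n₃ - + 2) * L (n₂ - + 2)) * F n₁
    + (F (n₃ - + 3) * F n₂ + F (n₃ - + 2) * L (n₂ - + 1)) * L (n₁ - + 1) ) * L n₀
  + ( (F (n₃ - + 3) * F (n₂ - + 1) + F (n₃ - + 2) * L (n₂ - + 2)) * F (n₁ - + 1)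
    + (F (n₃ - + 3) * F n₂ + F (n₃ - + 2) * L (n₂ - + 1)) * L (n₁ - + 2) ) * F (n₀ + + 1)
  ) * F (n₄ + + 1)
lemma3p4 con isConumerator +[1+ m₀ ] +[1+ m₁ ] +[1+ m₂ ] +[1+ m₃ ] +[1+ m₄ ]
  -- The codenominator is `con` of the reciprocal, so the outermost level uses only the second row
  -- of the matrix.
  = trans (con-recip-⊕-recip con isConumerator m₀ a₁ b₁)
      (continuant-identity
        (F +[1+ m₀ ]) (F (+ m₀)) (F +[1+ m₁ ]) (F (+ m₁)) (F +[1+ m₂ ]) (F (+ m₂))
        (F +[1+ m₃ ]) (F (+ m₃)) (F +[1+ m₄ ]) (F (+ m₄))
        (L[n] m₀) (F[n+1] m₀) (L[n-1] m₁) (L[n-2] m₁) (L[n-1] m₂) (L[n-2] m₂)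
        (F[n-2] m₃) (F[n-3] m₃) (F[n+1] m₄))
  where
  -- `Xᵢ` is the tail beginning at nᵢ; `aᵢ` and `bᵢ` evaluate `con` at that tail and at its
  -- reciprocal. They yield the nested polynomials of `continuant-identity` at qᵢ = F(nᵢ), pᵢ =
  -- F(nᵢ-1).
  X₄ X₃ X₂ : ℚ>0
  X₄ = fromℤ +[1+ m₄ ]
  X₃ = fromℤ +[1+ m₃ ] ⊕ recip X₄
  X₂ = fromℤ +[1+ m₂ ] ⊕ recip X₃
  a₄ = con-fromℤ con isConumerator m₄
  b₄ = con-recip-fromℤ con isConumerator m₄
  a₃ = con-⊕-recip con isConumerator m₃ {X₄} a₄ b₄
  b₃ = con-recip-⊕-recip con isConumerator m₃ {X₄} a₄ b₄
  a₂ = con-⊕-recip con isConumerator m₂ {X₃} a₃ b₃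
  b₂ = con-recip-⊕-recip con isConumerator m₂ {X₃} a₃ b₃
  a₁ = con-⊕-recip con isConumerator m₁ {X₂} a₂ b₂
  b₁ = con-recip-⊕-recip con isConumerator m₁ {X₂} a₂ b₂
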